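{- The implication problem is undecidable for the combination of unary conjunctive view containment dependencies and functional dependencies.
   Context: Fix a relational vocabulary $\sigma$. A view over $\sigma$ is a unary conjunctive query without equality and without negation, $V(y)\equiv\exists\bar x\,(R_1(u_1)\wedge\cdots\wedge R_k(u_k))$ with one free variable $y$. A unary conjunctive view containment dependency has the form $Q_1(x)\subseteq Q_2(x)$ or $Q_1(x)\subsetneq Q_2(x)$, where $Q_1,Q_2$ are first-order formulas with one free variable built from atoms $V(z)$ ($V$ a view) using $\neg$, $\wedge$, $\exists$; it holds in a structure if the set of elements satisfying $Q_1$ is contained (resp. properly contained) in the set satisfying $Q_2$. A functional dependency on a relation $R\in\sigma$ states that the values at a set of positions of tuples of $R$ determine the values at another set of positions. The implication problem asks whether a finite set of such dependencies implies a given one, i.e. whether every structure satisfying the set satisfies it. -}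

module Defs where

open import Data.Nat using (ℕ; suc)
open import Data.Fin using (Fin; zero; suc)
open import Data.Bool using (Bool)
open import Data.List using (List; []; _∷_; length; lookup; concatMap)
open import Data.List.Membership.Propositional using (_∈_)
open import Data.List.Relation.Unary.All using (All)
open import Data.Product using (Σ; _×_; _,_; proj₁; proj₂)
open import Data.Sum using (_⊎_)
open import Relation.Binary.PropositionalEquality using (_≡_)
open import Relation.Nullary using (¬_)
open import Function.Bundles using (_⇔_)

record Vocabulary : Set where
  field
    nRel  : ℕ
    arity : Fin nRel → ℕ
open Vocabulary public

record Structure (σ : Vocabulary) : Set₁ where
  field
    Dom : Set
    Rel : (R : Fin (nRel σ)) → (Fin (arity σ R) → Dom) → Set
open Structure public

-- Views: unary conjunctive queries without equality and negation.
-- Variables are Fin (suc m): zero is the free variable y, suc i are the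
-- m existentially quantified variables x̄.

record Atom (σ : Vocabulary) (m : ℕ) : Set where
  constructor atom
  field
    rel  : Fin (nRel σ)
    args : Fin (arity σ rel) → Fin (suc m)

record View (σ : Vocabulary) : Set where
  constructor view
  field
    nExVars : ℕ
    atoms   : List (Atom σ nExVars)
open View public

_◂_ : {D : Set} {m : ℕ} → D → (Fin m → D) → Fin (suc m) → D
(d ◂ a) zero    = d
(d ◂ a) (suc i) = a i

AtomHolds : {σ : Vocabulary} (S : Structure σ) {m : ℕ} →
            (Fin (suc m) → Dom S) → Atom σ m → Set
AtomHolds S ν (atom R us) = Rel S R (λ j → ν (us j))

ViewHolds : {σ : Vocabulary} (S : Structure σ) → View σ → Dom S → Set
ViewHolds S (view m as) d =
  Σ (Fin m → Dom S) λ a → All (AtomHolds S (d ◂ a)) as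

-- First-order formulas over view atoms, built with ¬, ∧, ∃.
-- nV = number of views available, n = number of free variables
-- (de Bruijn style; ∃ binds variable zero).

data VFormula (nV : ℕ) : ℕ → Set where
  vatom : {n : ℕ} → Fin nV → Fin n → VFormula nV n
  ¬'_   : {n : ℕ} → VFormula nV n → VFormula nV n
  _∧'_  : {n : ℕ} → VFormula nV n → VFormula nV n → VFormula nV n
  ∃'_   : {n : ℕ} → VFormula nV (suc n) → VFormula nV n

⟦_⟧ : {σ : Vocabulary} {nV n : ℕ} → VFormula nV n →
      (S : Structure σ) → (Fin nV → View σ) → (Fin n → Dom S) → Set
⟦ vatom V z ⟧ S vs ρ = ViewHolds S (vs V) (ρ z)
⟦ ¬' φ ⟧      S vs ρ = ¬ (⟦ φ ⟧ S vs ρ)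
⟦ φ ∧' ψ ⟧    S vs ρ = ⟦ φ ⟧ S vs ρ × ⟦ ψ ⟧ S vs ρ
⟦ ∃' φ ⟧      S vs ρ = Σ (Dom S) λ d → ⟦ φ ⟧ S vs (d ◂ ρ)

QHolds : {σ : Vocabulary} {nV : ℕ} → VFormula nV 1 →
         (S : Structure σ) → (Fin nV → View σ) → Dom S → Set
QHolds Q S vs d = ⟦ Q ⟧ S vs (λ _ → d)

data Dependency (σ : Vocabulary) (nV : ℕ) : Set where
  _⊆'_ : VFormula nV 1 → VFormula nV 1 → Dependency σ nV
  _⊊'_ : VFormula nV 1 → VFormula nV 1 → Dependency σ nV
  fd   : (R : Fin (nRel σ)) → List (Fin (arity σ R)) →
         List (Fin (arity σ R)) → Dependency σ nV

Contained : {σ : Vocabulary} {nV : ℕ} → (S : Structure σ) →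
            (Fin nV → View σ) → VFormula nV 1 → VFormula nV 1 → Set
Contained S vs Q₁ Q₂ = (d : Dom S) → QHolds Q₁ S vs d → QHolds Q₂ S vs d

Satisfies : {σ : Vocabulary} {nV : ℕ} → (S : Structure σ) →
            (Fin nV → View σ) → Dependency σ nV → Set
Satisfies S vs (Q₁ ⊆' Q₂) = Contained S vs Q₁ Q₂
Satisfies S vs (Q₁ ⊊' Q₂) = Contained S vs Q₁ Q₂ × ¬ Contained S vs Q₂ Q₁
Satisfies {σ} S vs (fd R X Y) =
  (t t′ : Fin (arity σ R) → Dom S) → Rel S R t → Rel S R t′ →
  ((i : Fin (arity σ R)) → i ∈ X → t i ≡ t′ i) →
  ((j : Fin (arity σ R)) → j ∈ Y → t j ≡ t′ j)

record ImplicationInstance : Set where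
  field
    voc    : Vocabulary
    nViews : ℕ
    views  : Fin nViews → View voc
    premises   : List (Dependency voc nViews)
    conclusion : Dependency voc nViews
open ImplicationInstance public

Implied : ImplicationInstance → Set₁
Implied I = (S : Structure (voc I)) →
            All (Satisfies S (views I)) (premises I) →
            Satisfies S (views I) (conclusion I)

-- Undecidability, expressed as a (computable, since every Agda function
-- is) many-one reduction from the Post Correspondence Problem or from
-- its complement.

PCPInstance : Set
PCPInstance = List (List Bool × List Bool)

PCPSolvable : PCPInstance → Set
PCPSolvable P =
  Σ (Fin (length P)) λ i → Σ (List (Fin (length P))) λ is →
    concatMap (λ k → proj₁ (lookup P k)) (i ∷ is)
      ≡ concatMap (λ k → proj₂ (lookup P k)) (i ∷ is)

Undecidable : {A : Set} → (A → Set₁) → Set₁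
Undecidable {A} P =
  (Σ (PCPInstance → A) λ f → (p : PCPInstance) → PCPSolvable p ⇔ P (f p))
  ⊎ (Σ (PCPInstance → A) λ f → (p : PCPInstance) → PCPSolvable p ⇔ (¬ P (f p)))

-- Reduction from PCP. Elements of Conf are configurations (tile sequences in
-- the intended model); Top and Bot point from a configuration to word nodes,
-- and S0/S1-edges spell words between word nodes. The tile views force every
-- configuration to have, for each tile, a Done successor configuration whose
-- word nodes are reached from the predecessor's by spelling the tile's top and
-- bottom words. All these relations are functional, so spelling is
-- deterministic: a solution i ∷ is makes the top and bottom word nodes of the
-- configuration reached along i ∷ is coincide, and then the functional key
-- relation K sends both to one key, which cannot be labelled by both of the
-- disjoint predicates A and B; hence that configuration is Done but not in the
-- clash view N. Conversely, in the term model the clash view holds at exactly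
-- the configurations whose top and bottom words differ, so the implied
-- dependency yields a tile sequence whose words do not differ, hence agree,
-- equality of words being decidable.
module Submission where

open import Defs
open import Data.Nat using (ℕ; zero; suc; _+_)
open import Data.Nat.Properties using (≤-reflexive)
open import Data.Fin using (Fin; zero; suc; _↑ˡ_; _↑ʳ_; splitAt; fromℕ; toℕ)
open import Data.Fin.Properties using (splitAt-↑ˡ; splitAt-↑ʳ; toℕ-fromℕ)
open import Data.Bool using (Bool; true; false)
open import Data.Bool.Properties using () renaming (_≟_ to _≟ᵇ_)
open import Data.List using (List; []; _∷_; _++_; [_]; length; lookup; concatMap; take; tabulate)
open import Data.List.Properties using (++-identityʳ; ++-assoc; concatMap-++; take-all; ≡-dec)
open import Data.List.Membership.Propositional using (_∈_)
open import Data.List.Relation.Unary.All using (All; []; _∷_)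
open import Data.List.Relation.Unary.All.Properties using (++⁺; ++⁻; tabulate⁺; tabulate⁻)
open import Data.List.Relation.Unary.Any using (here; there)
open import Data.Product using (Σ; _×_; _,_; proj₁; proj₂)
open import Data.Sum using (inj₁; [_,_]′)
open import Data.Empty using (⊥-elim)
open import Function using (_∘_)
open import Function.Bundles using (mk⇔)
open import Function.Definitions using (Injective)
open import Relation.Binary.PropositionalEquality using (_≡_; refl; sym; trans; cong; subst)
open import Relation.Nullary using (¬_; yes; no)

pattern rInit = zero
pattern rConf = suc zero
pattern rDone = suc (suc zero)
pattern rTop  = suc (suc (suc zero))
pattern rBot  = suc (suc (suc (suc zero)))
pattern rS0   = suc (suc (suc (suc (suc zero))))
pattern rS1   = suc (suc (suc (suc (suc (suc zero)))))
pattern rK    = suc (suc (suc (suc (suc (suc (suc zero))))))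
pattern rA    = suc (suc (suc (suc (suc (suc (suc (suc zero)))))))
pattern rB    = suc (suc (suc (suc (suc (suc (suc (suc (suc zero))))))))

arities : Fin 10 → ℕ
arities rInit = 1
arities rConf = 1
arities rDone = 1
arities rTop  = 2
arities rBot  = 2
arities rS0   = 2
arities rS1   = 2
arities rK    = 3
arities rA    = 1
arities rB    = 1

σ₀ : Vocabulary
σ₀ = record { nRel = 10 ; arity = arities }

pair : {A : Set} → A → A → Fin 2 → A
pair x y zero    = x
pair x y (suc _) = y

triple : {A : Set} → A → A → A → Fin 3 → A
triple x y z zero          = x
triple x y z (suc zero)    = y
triple x y z (suc (suc _)) = z

module _ {D : Set} where

  Edge : ((Fin 2 → D) → Set) → D → D → Set
  Edge Q x y = Σ (Fin 2 → D) λ t → Q t × t zero ≡ x × t (suc zero) ≡ y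

  -- Literally Satisfies of fd R (zero ∷ []) (suc zero ∷ []) for a binary R.
  Functional : ((Fin 2 → D) → Set) → Set
  Functional Q = (t t′ : Fin 2 → D) → Q t → Q t′ →
                 ((i : Fin 2) → i ∈ zero ∷ [] → t i ≡ t′ i) →
                 ((j : Fin 2) → j ∈ suc zero ∷ [] → t j ≡ t′ j)

  edge-functional : {Q : (Fin 2 → D) → Set} {x y y′ : D} →
                    Functional Q → Edge Q x y → Edge Q x y′ → y ≡ y′
  edge-functional functional (t , qt , t₀ , t₁) (t′ , qt′ , t′₀ , t′₁) =
    trans (sym t₁) (trans (functional t t′ qt qt′ agree (suc zero) (here refl)) t′₁)
    where
      agree : (i : Fin 2) → i ∈ zero ∷ [] → t i ≡ t′ i
      agree .zero (here refl) = trans t₀ (sym t′₀)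

  edge-of-pair : {V : Set} {Q : (Fin 2 → D) → Set} (ν : V → D) {v w : V} →
                 Q (λ j → ν (pair v w j)) → Edge Q (ν v) (ν w)
  edge-of-pair ν {v} {w} q = (λ j → ν (pair v w j)) , q , refl , refl

module _ {D : Set} (Letter : Bool → D → D → Set) where

  Path : List Bool → D → D → Set
  Path []      x y = x ≡ y
  Path (b ∷ u) x y = Σ D λ z → Letter b x z × Path u z y

  path-++ : (u w : List Bool) {x y z : D} → Path u x y → Path w y z → Path (u ++ w) x z
  path-++ []      w refl        q = q
  path-++ (b ∷ u) w (z , e , p) q = z , e , path-++ u w p q

  path-deterministic : ((b : Bool) {x y y′ : D} → Letter b x y → Letter b x y′ → y ≡ y′) →
                       (u : List Bool) {x y y′ : D} → Path u x y → Path u x y′ → y ≡ y′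
  path-deterministic det []      refl        refl          = refl
  path-deterministic det (b ∷ u) (z , e , p) (z′ , e′ , p′) with det b e e′
  ... | refl = path-deterministic det u p p′

letterAtom : {m : ℕ} → Bool → Fin (suc m) → Fin (suc m) → Atom σ₀ m
letterAtom false v w = atom rS0 (pair v w)
letterAtom true  v w = atom rS1 (pair v w)

chain : {m : ℕ} (u : List Bool) → (Fin (suc (length u)) → Fin (suc m)) → List (Atom σ₀ m)
chain []      vs = []
chain (b ∷ u) vs = letterAtom b (vs zero) (vs (suc zero)) ∷ chain u (vs ∘ suc)

LetterEdge : (S : Structure σ₀) → Bool → Dom S → Dom S → Set
LetterEdge S false = Edge (Rel S rS0)
LetterEdge S true  = Edge (Rel S rS1)

chain-path : (S : Structure σ₀) {m : ℕ} (u : List Bool)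
             (vs : Fin (suc (length u)) → Fin (suc m)) (ν : Fin (suc m) → Dom S) →
             All (AtomHolds S ν) (chain u vs) →
             Path (LetterEdge S) u (ν (vs zero)) (ν (vs (fromℕ (length u))))
chain-path S []          vs ν []       = refl
chain-path S (false ∷ u) vs ν (h ∷ hs) = _ , edge-of-pair ν h , chain-path S u (vs ∘ suc) ν hs
chain-path S (true  ∷ u) vs ν (h ∷ hs) = _ , edge-of-pair ν h , chain-path S u (vs ∘ suc) ν hs

pattern vInit  = zero
pattern vConf  = suc zero
pattern vDone  = suc (suc zero)
pattern vA     = suc (suc (suc zero))
pattern vB     = suc (suc (suc (suc zero)))
pattern vStart = suc (suc (suc (suc (suc zero))))
pattern vClash = suc (suc (suc (suc (suc (suc zero)))))
pattern vTile i = suc (suc (suc (suc (suc (suc (suc i))))))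

module Reduction (P : PCPInstance) where

  Tile : Set
  Tile = Fin (length P)

  top bot : Tile → List Bool
  top i = proj₁ (lookup P i)
  bot i = proj₂ (lookup P i)

  topWord botWord : List Tile → List Bool
  topWord = concatMap top
  botWord = concatMap bot

  unaryView : Fin 10 → View σ₀
  unaryView R = view 0 (atom R (λ _ → zero) ∷ [])

  startView : View σ₀
  startView = view 1 (atom rConf (λ _ → zero) ∷ atom rTop (pair zero (suc zero)) ∷
                      atom rBot (pair zero (suc zero)) ∷ [])

  clashView : View σ₀
  clashView = view 4 (atom rTop (pair zero x) ∷ atom rBot (pair zero y) ∷
                      atom rK (triple zero x k) ∷ atom rK (triple zero y l) ∷
                      atom rA (λ _ → k) ∷ atom rB (λ _ → l) ∷ [])
    where
      x y k l : Fin 5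
      x = suc zero
      y = suc (suc zero)
      k = suc (suc (suc zero))
      l = suc (suc (suc (suc zero)))

  -- For the tile i with words u, v: the view
  --   ∃ c′ x₀…x_|u| y₀…y_|v|. Conf(c′) ∧ Done(c′) ∧ Top(c,x₀) ∧ Bot(c,y₀)
  --     ∧ Top(c′,x_|u|) ∧ Bot(c′,y_|v|) ∧ chain u x ∧ chain v y
  module TileView (i : Tile) where
    u v : List Bool
    u = top i
    v = bot i

    M : ℕ
    M = suc (suc (length u) + suc (length v))

    c′ : Fin (suc M)
    c′ = suc zero

    xs : Fin (suc (length u)) → Fin (suc M)
    xs k = suc (suc (k ↑ˡ suc (length v)))

    ys : Fin (suc (length v)) → Fin (suc M)
    ys k = suc (suc (suc (length u) ↑ʳ k))

    endpoints : List (Atom σ₀ M)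
    endpoints = atom rConf (λ _ → c′) ∷ atom rDone (λ _ → c′) ∷
                atom rTop (pair zero (xs zero)) ∷ atom rBot (pair zero (ys zero)) ∷
                atom rTop (pair c′ (xs (fromℕ (length u)))) ∷
                atom rBot (pair c′ (ys (fromℕ (length v)))) ∷ []

    tileView : View σ₀
    tileView = view M (endpoints ++ (chain u xs ++ chain v ys))

  open TileView using (tileView)

  views₀ : Fin (7 + length P) → View σ₀
  views₀ vInit     = unaryView rInit
  views₀ vConf     = unaryView rConf
  views₀ vDone     = unaryView rDone
  views₀ vA        = unaryView rA
  views₀ vB        = unaryView rB
  views₀ vStart    = startView
  views₀ vClash    = clashView
  views₀ (vTile i) = tileView i

  V : Fin (7 + length P) → VFormula (7 + length P) 1
  V k = vatom k zero

  tileStep : Tile → Dependency σ₀ (7 + length P)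
  tileStep i = V vConf ⊆' V (vTile i)

  premises₀ : List (Dependency σ₀ (7 + length P))
  premises₀ = (V vInit ⊆' V vStart) ∷
              fd rTop (zero ∷ []) (suc zero ∷ []) ∷
              fd rBot (zero ∷ []) (suc zero ∷ []) ∷
              fd rS0 (zero ∷ []) (suc zero ∷ []) ∷
              fd rS1 (zero ∷ []) (suc zero ∷ []) ∷
              fd rK (zero ∷ suc zero ∷ []) (suc (suc zero) ∷ []) ∷
              ((V vA ∧' V vB) ⊆' (¬' V vA)) ∷
              tabulate tileStep

  conclusion₀ : Dependency σ₀ (7 + length P)
  conclusion₀ = V vInit ⊆' (∃' (vatom vDone zero ∧' (¬' vatom vClash zero)))

  instance₀ : ImplicationInstance
  instance₀ = record { voc = σ₀ ; nViews = 7 + length P ; views = views₀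
                     ; premises = premises₀ ; conclusion = conclusion₀ }

  -- Soundness

  module Soundness (S : Structure σ₀)
                   (top-fd : Functional (Rel S rTop)) (bot-fd : Functional (Rel S rBot))
                   (s0-fd : Functional (Rel S rS0)) (s1-fd : Functional (Rel S rS1))
                   (tile-premises : All (Satisfies S views₀) (tabulate tileStep)) where

    D : Set
    D = Dom S

    Conf Done : D → Set
    Conf c = Rel S rConf (λ _ → c)
    Done c = Rel S rDone (λ _ → c)

    TopEdge BotEdge : D → D → Set
    TopEdge = Edge (Rel S rTop)
    BotEdge = Edge (Rel S rBot)

    Spells : List Bool → D → D → Set
    Spells = Path (LetterEdge S)

    spelling-deterministic : (u : List Bool) {x y y′ : D} → Spells u x y → Spells u x y′ → y ≡ y′
    spelling-deterministic = path-deterministic (LetterEdge S) letter-functional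
      where
        letter-functional : (b : Bool) {x y y′ : D} → LetterEdge S b x y → LetterEdge S b x y′ → y ≡ y′
        letter-functional false = edge-functional s0-fd
        letter-functional true  = edge-functional s1-fd

    record Run (w₁ w₂ : D) (u v : List Bool) : Set where
      field
        end          : D
        end-conf     : Conf end
        end-done     : Done end
        topNode      : D
        botNode      : D
        end-top      : TopEdge end topNode
        end-bot      : BotEdge end botNode
        spells-top   : Spells u w₁ topNode
        spells-bot   : Spells v w₂ botNode
    open Run public

    stay : {w₁ w₂ : D} {u v : List Bool} (r : Run w₁ w₂ u v) → Run (topNode r) (botNode r) [] []
    stay r = record
      { end = end r ; end-conf = end-conf r ; end-done = end-done r
      ; end-top = end-top r ; end-bot = end-bot r ; spells-top = refl ; spells-bot = refl }

    run-++ : {w₁ w₂ : D} {u v u′ v′ : List Bool} (r : Run w₁ w₂ u v) →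
             Run (topNode r) (botNode r) u′ v′ → Run w₁ w₂ (u ++ u′) (v ++ v′)
    run-++ {u = u} {v} r r′ = record
      { end = end r′ ; end-conf = end-conf r′ ; end-done = end-done r′
      ; end-top = end-top r′ ; end-bot = end-bot r′
      ; spells-top = path-++ (LetterEdge S) u _ (spells-top r) (spells-top r′)
      ; spells-bot = path-++ (LetterEdge S) v _ (spells-bot r) (spells-bot r′) }

    tile-step : (i : Tile) {c w₁ w₂ : D} → Conf c → TopEdge c w₁ → BotEdge c w₂ →
                Run w₁ w₂ (top i) (bot i)
    tile-step i {c} conf top₀ bot₀
      with tabulate⁻ tile-premises i c ((λ ()) , (conf ∷ []))
    ... | a , (conf′ ∷ done′ ∷ top₀′ ∷ bot₀′ ∷ top′ ∷ bot′ ∷ chains)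
      with ++⁻ (chain (top i) (TileView.xs i)) chains
    ... | top-chain , bot-chain = record
      { end        = a zero
      ; end-conf   = conf′
      ; end-done   = done′
      ; end-top    = edge-of-pair ν top′
      ; end-bot    = edge-of-pair ν bot′
      ; spells-top = subst (λ z → Spells u z _)
                           (edge-functional top-fd (edge-of-pair ν top₀′) top₀)
                           (chain-path S u xs ν top-chain)
      ; spells-bot = subst (λ z → Spells v z _)
                           (edge-functional bot-fd (edge-of-pair ν bot₀′) bot₀)
                           (chain-path S v ys ν bot-chain) }
      where
        open TileView i
        ν : Fin (suc M) → D
        ν = c ◂ a

    tiles-run : (i : Tile) (is : List Tile) {c w₁ w₂ : D} → Conf c → TopEdge c w₁ → BotEdge c w₂ →
                Run w₁ w₂ (topWord (i ∷ is)) (botWord (i ∷ is))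
    tiles-run i is conf top₀ bot₀ = run-++ r (continue is)
      where
        r = tile-step i conf top₀ bot₀
        continue : (is : List Tile) → Run (topNode r) (botNode r) (topWord is) (botWord is)
        continue []       = stay r
        continue (j ∷ js) = tiles-run j js (end-conf r) (end-top r) (end-bot r)

    no-clash : (k-fd : Satisfies S views₀ (fd rK (zero ∷ suc zero ∷ []) (suc (suc zero) ∷ [])))
               (disjoint : Satisfies S views₀ ((V vA ∧' V vB) ⊆' (¬' V vA)))
               {c x : D} → TopEdge c x → BotEdge c x → ¬ ViewHolds S clashView c
    no-clash k-fd disjoint {c} at-top at-bot (a , (top′ ∷ bot′ ∷ key₁ ∷ key₂ ∷ inA ∷ inB ∷ [])) =
      disjoint (a k) (((λ ()) , (inA ∷ [])) , ((λ ()) , (inB′ ∷ []))) ((λ ()) , (inA ∷ []))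
      where
        k l : Fin 4
        k = suc (suc zero)
        l = suc (suc (suc zero))
        same-node : (j : Fin 3) → j ∈ zero ∷ suc zero ∷ [] →
                    (c ◂ a) (triple zero (suc zero) (suc k) j) ≡ (c ◂ a) (triple zero (suc (suc zero)) (suc l) j)
        same-node .zero (here refl) = refl
        same-node .(suc zero) (there (here refl)) =
          trans (edge-functional top-fd (edge-of-pair (c ◂ a) top′) at-top)
                (sym (edge-functional bot-fd (edge-of-pair (c ◂ a) bot′) at-bot))
        inB′ : Rel S rB (λ _ → a k)
        inB′ = subst (λ z → Rel S rB (λ _ → z))
                     (sym (k-fd _ _ key₁ key₂ same-node (suc (suc zero)) (here refl))) inB

  sound : PCPSolvable P → Implied instance₀
  sound (i , is , equal) S (start ∷ top-fd ∷ bot-fd ∷ s0-fd ∷ s1-fd ∷ k-fd ∷ disjoint ∷ tile-premises) d init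
    with start d init
  ... | a , (conf ∷ top₀ ∷ bot₀ ∷ []) =
    end r , ((λ ()) , (end-done r ∷ [])) , no-clash k-fd disjoint (end-top r) bot-at-top
    where
      open Soundness S top-fd bot-fd s0-fd s1-fd tile-premises
      r = tiles-run i is conf (edge-of-pair (d ◂ a) top₀) (edge-of-pair (d ◂ a) bot₀)
      bot-at-top : BotEdge (end r) (topNode r)
      bot-at-top = subst (BotEdge (end r))
        (spelling-deterministic (botWord (i ∷ is))
          (spells-bot r) (subst (λ w → Spells w (a zero) (topNode r)) equal (spells-top r)))
        (end-bot r)

  -- Completeness, via the term model

  data Term : Set where
    cfg : List Tile → Term
    wrd : List Bool → Term
    key : List Tile → List Bool → Term

  cfg-injective : Injective _≡_ _≡_ cfg
  cfg-injective refl = refl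

  wrd-injective : Injective _≡_ _≡_ wrd
  wrd-injective refl = refl

  key-injective : {s s′ : List Tile} {w w′ : List Bool} → key s w ≡ key s′ w′ → s ≡ s′ × w ≡ w′
  key-injective refl = refl , refl

  Graph : {A : Set} → (A → Term) → (A → Term) → (Fin 2 → Term) → Set
  Graph {A} f g t = Σ A λ a → t zero ≡ f a × t (suc zero) ≡ g a

  graph-functional : {A : Set} {f g : A → Term} → Injective _≡_ _≡_ f → Functional (Graph f g)
  graph-functional f-inj t t′ (a , t₀ , t₁) (a′ , t′₀ , t′₁) agree .(suc zero) (here refl)
    with f-inj (trans (sym t₀) (trans (agree zero (here refl)) t′₀))
  ... | refl = trans t₁ (sym t′₁)

  termRel : (R : Fin 10) → (Fin (arities R) → Term) → Set
  termRel rInit t = t zero ≡ cfg []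
  termRel rConf t = Σ (List Tile) λ s → t zero ≡ cfg s
  termRel rDone t = Σ Tile λ i → Σ (List Tile) λ is → t zero ≡ cfg (i ∷ is)
  termRel rTop  t = Graph cfg (wrd ∘ topWord) t
  termRel rBot  t = Graph cfg (wrd ∘ botWord) t
  termRel rS0   t = Graph wrd (λ w → wrd (w ++ [ false ])) t
  termRel rS1   t = Graph wrd (λ w → wrd (w ++ [ true ])) t
  termRel rK    t = Σ (List Tile) λ s → Σ (List Bool) λ w →
                      t zero ≡ cfg s × t (suc zero) ≡ wrd w × t (suc (suc zero)) ≡ key s w
  termRel rA    t = Σ (List Tile) λ s → t zero ≡ key s (topWord s)
  termRel rB    t = Σ (List Tile) λ s → t zero ≡ key s (botWord s) × ¬ topWord s ≡ botWord s

  termModel : Structure σ₀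
  termModel = record { Dom = Term ; Rel = termRel }

  letterAtom-holds : (b : Bool) {m : ℕ} (ν : Fin (suc m) → Term) {v w : Fin (suc m)} (x : List Bool) →
                     ν v ≡ wrd x → ν w ≡ wrd (x ++ [ b ]) → AtomHolds termModel ν (letterAtom b v w)
  letterAtom-holds false ν x before after = x , before , after
  letterAtom-holds true  ν x before after = x , before , after

  chain-holds : {m : ℕ} (u : List Bool) (vs : Fin (suc (length u)) → Fin (suc m))
                (ν : Fin (suc m) → Term) (w : List Bool) →
                ((k : Fin (suc (length u))) → ν (vs k) ≡ wrd (w ++ take (toℕ k) u)) →
                All (AtomHolds termModel ν) (chain u vs)
  chain-holds []      vs ν w prefix = []
  chain-holds (b ∷ u) vs ν w prefix =
    letterAtom-holds b ν w (trans (prefix zero) (cong wrd (++-identityʳ w))) (prefix (suc zero)) ∷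
    chain-holds u (vs ∘ suc) ν (w ++ [ b ])
      (λ k → trans (prefix (suc k)) (cong wrd (sym (++-assoc w [ b ] (take (toℕ k) u)))))

  take-whole : (u : List Bool) → take (toℕ (fromℕ (length u))) u ≡ u
  take-whole u = take-all _ u (≤-reflexive (sym (toℕ-fromℕ (length u))))

  word-after-tile : (word : Tile → List Bool) (s : List Tile) (i : Tile) →
                    concatMap word s ++ take (toℕ (fromℕ (length (word i)))) (word i)
                      ≡ concatMap word (s ++ [ i ])
  word-after-tile word s i rewrite take-whole (word i) | concatMap-++ word s [ i ]
                                 | ++-identityʳ (word i) = refl

  nonempty-snoc : (s : List Tile) (i : Tile) → Σ Tile λ j → Σ (List Tile) λ js → s ++ [ i ] ≡ j ∷ js
  nonempty-snoc []      i = i , [] , refl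
  nonempty-snoc (j ∷ s) i = j , s ++ [ i ] , refl

  -- The successor of the configuration s under tile i is s ++ [ i ].
  tile-step-holds : (i : Tile) → Satisfies termModel views₀ (tileStep i)
  tile-step-holds i d (_ , ((s , refl) ∷ [])) =
    a , ++⁺ endpoints-hold (++⁺ (chain-holds u xs ν (topWord s) xs-prefix)
                                (chain-holds v ys ν (botWord s) ys-prefix))
    where
      open TileView i
      a : Fin M → Term
      a zero    = cfg (s ++ [ i ])
      a (suc j) = [ (λ k → wrd (topWord s ++ take (toℕ k) u))
                  , (λ k → wrd (botWord s ++ take (toℕ k) v)) ]′ (splitAt (suc (length u)) j)
      ν : Fin (suc M) → Term
      ν = cfg s ◂ a
      xs-prefix : (k : Fin (suc (length u))) → ν (xs k) ≡ wrd (topWord s ++ take (toℕ k) u)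
      xs-prefix k rewrite splitAt-↑ˡ (suc (length u)) k (suc (length v)) = refl
      ys-prefix : (k : Fin (suc (length v))) → ν (ys k) ≡ wrd (botWord s ++ take (toℕ k) v)
      ys-prefix k rewrite splitAt-↑ʳ (suc (length u)) (suc (length v)) k = refl
      done : Σ Tile λ j → Σ (List Tile) λ js → cfg (s ++ [ i ]) ≡ cfg (j ∷ js)
      done with nonempty-snoc s i
      ... | j , js , snoc = j , js , cong cfg snoc
      endpoints-hold : All (AtomHolds termModel ν) endpoints
      endpoints-hold =
        (s ++ [ i ] , refl) ∷ done ∷
        (s , refl , trans (xs-prefix zero) (cong wrd (++-identityʳ (topWord s)))) ∷
        (s , refl , trans (ys-prefix zero) (cong wrd (++-identityʳ (botWord s)))) ∷
        (s ++ [ i ] , refl , trans (xs-prefix (fromℕ (length u))) (cong wrd (word-after-tile top s i))) ∷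
        (s ++ [ i ] , refl , trans (ys-prefix (fromℕ (length v))) (cong wrd (word-after-tile bot s i))) ∷ []

  termModel-premises : All (Satisfies termModel views₀) premises₀
  termModel-premises =
    start ∷ graph-functional cfg-injective ∷ graph-functional cfg-injective ∷
    graph-functional wrd-injective ∷ graph-functional wrd-injective ∷ key-fd ∷ disjoint ∷
    tabulate⁺ tile-step-holds
    where
      start : Satisfies termModel views₀ (V vInit ⊆' V vStart)
      start d (_ , (init ∷ [])) =
        (λ _ → wrd []) , (([] , init) ∷ ([] , init , refl) ∷ ([] , init , refl) ∷ [])
      key-fd : Satisfies termModel views₀ (fd rK (zero ∷ suc zero ∷ []) (suc (suc zero) ∷ []))
      key-fd t t′ (s , w , t₀ , t₁ , t₂) (s′ , w′ , t′₀ , t′₁ , t′₂) agree .(suc (suc zero)) (here refl)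
        with cfg-injective (trans (sym t₀) (trans (agree zero (here refl)) t′₀))
           | wrd-injective (trans (sym t₁) (trans (agree (suc zero) (there (here refl))) t′₁))
      ... | refl | refl = trans t₂ (sym t′₂)
      disjoint : Satisfies termModel views₀ ((V vA ∧' V vB) ⊆' (¬' V vA))
      disjoint d ((_ , ((s , inA) ∷ [])) , (_ , ((s′ , inB , differ) ∷ []))) _
        with key-injective (trans (sym inA) inB)
      ... | refl , same = differ same

  clash-of-mismatch : (s : List Tile) → ¬ topWord s ≡ botWord s → ViewHolds termModel clashView (cfg s)
  clash-of-mismatch s differ =
    a , ((s , refl , refl) ∷ (s , refl , refl) ∷ (s , topWord s , refl , refl , refl) ∷
         (s , botWord s , refl , refl , refl) ∷ (s , refl) ∷ (s , refl , differ) ∷ [])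
    where
      a : Fin 4 → Term
      a zero                = wrd (topWord s)
      a (suc zero)          = wrd (botWord s)
      a (suc (suc zero))    = key s (topWord s)
      a (suc (suc (suc _))) = key s (botWord s)

  complete : Implied instance₀ → PCPSolvable P
  complete implied with implied termModel termModel-premises (cfg []) ((λ ()) , (refl ∷ []))
  ... | _ , (_ , ((i , is , refl) ∷ [])) , not-clash
    with ≡-dec _≟ᵇ_ (topWord (i ∷ is)) (botWord (i ∷ is))
  ... | yes equal  = i , is , equal
  ... | no differ = ⊥-elim (not-clash (clash-of-mismatch (i ∷ is) differ))

corollary6p3 : Undecidable Implied
corollary6p3 = inj₁ (Reduction.instance₀ , λ P → mk⇔ (Reduction.sound P) (Reduction.complete P))
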